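{- Let $m \geq 3$ and $n \ge 6$. Then $$\left(\left\lfloor \frac{m}{3}\right\rfloor + \alpha \right) n \le \gamma_{r2}(C_{m} \Box C_n) \le \min \left\{ \left\lceil \frac{m}{3}\right\rceil ( n + \beta),\ \left\lceil \frac{n}{3}\right\rceil (m + \gamma) \right\},$$ where $\alpha = 0$ if $m \equiv 0 \pmod 3$, $\alpha=\frac12$ if $m \equiv 1 \pmod 3$, $\alpha = 1$ if $m \equiv 2 \pmod 3$; $\beta = 0$ if $n \equiv 0 \pmod 6$, $\beta=1$ if $n \equiv 1,2,3,5 \pmod 6$, $\beta=2$ if $n \equiv 4 \pmod 6$; and $\gamma = 0$ if $m \equiv 0 \pmod 6$, $\gamma=1$ if $m \equiv 5 \pmod 6$, $\gamma = 2$ if $m \equiv 1,2,3,4 \pmod 6$.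
   Context: For a graph $G$, a 2-rainbow dominating function (2RDF) is a function $f$ assigning to each vertex a subset of $\{1,2\}$ such that every vertex $v$ with $f(v)=\emptyset$ satisfies $\bigcup_{u\in N(v)} f(u)=\{1,2\}$, where $N(v)$ is the open neighborhood of $v$. Its weight is $w(f)=\sum_{v\in V(G)}|f(v)|$, and $\gamma_{r2}(G)$ is the minimum weight of a 2RDF of $G$. $C_m \Box C_n$ denotes the Cartesian product of the cycles $C_m$ and $C_n$. -}

module Defs where

open import Data.Nat using (ℕ; zero; suc; _+_; _*_; _≤_; _/_; _%_)
open import Data.Fin using (Fin; toℕ)
import Data.Fin as F
open import Data.Product using (Σ; _×_; _,_)
open import Data.Sum using (_⊎_)
open import Data.Bool using (Bool; true; false; _∨_)
open import Relation.Binary.PropositionalEquality using (_≡_)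

-- Adjacency in the cycle C_m on vertex set Fin m (i ~ i±1 mod m); for m ≥ 3 this is simple.
CycleAdj : (m : ℕ) → Fin m → Fin m → Set
CycleAdj m i j = ((toℕ i + 1) % suc (pred' m) ≡ toℕ j) ⊎ ((toℕ j + 1) % suc (pred' m) ≡ toℕ i)
  where
  pred' : ℕ → ℕ
  pred' zero = zero
  pred' (suc k) = k

Vertex : ℕ → ℕ → Set
Vertex m n = Fin m × Fin n

TorusAdj : (m n : ℕ) → Vertex m n → Vertex m n → Set
TorusAdj m n (i , j) (i' , j') = (i ≡ i' × CycleAdj n j j') ⊎ (j ≡ j' × CycleAdj m i i')

-- A subset of {1,2}, given by membership of 1 and of 2.
record Label : Set where
  constructor lab
  field
    has1 : Bool
    has2 : Bool
open Label public

∣_∣L : Label → ℕ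
∣ lab a b ∣L = b2n a + b2n b
  where
  b2n : Bool → ℕ
  b2n true = 1
  b2n false = 0

IsEmpty : Label → Set
IsEmpty l = (has1 l ≡ false) × (has2 l ≡ false)

Is2RDF : (m n : ℕ) → (Vertex m n → Label) → Set
Is2RDF m n f = (v : Vertex m n) → IsEmpty (f v) →
  (Σ (Vertex m n) λ u → TorusAdj m n v u × has1 (f u) ≡ true) ×
  (Σ (Vertex m n) λ u → TorusAdj m n v u × has2 (f u) ≡ true)

sumFin : (k : ℕ) → (Fin k → ℕ) → ℕ
sumFin zero g = 0
sumFin (suc k) g = g F.zero + sumFin k (λ i → g (F.suc i))

weight : (m n : ℕ) → (Vertex m n → Label) → ℕ
weight m n f = sumFin m λ i → sumFin n λ j → ∣ f (i , j) ∣L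

IsRDNumber : (m n : ℕ) → ℕ → Set
IsRDNumber m n k =
  (Σ (Vertex m n → Label) λ f → Is2RDF m n f × weight m n f ≡ k) ×
  ((f : Vertex m n → Label) → Is2RDF m n f → k ≤ weight m n f)

⌈_/3⌉ : ℕ → ℕ
⌈ k /3⌉ = (k + 2) / 3

twoAlpha : ℕ → ℕ
twoAlpha m with m % 3
... | 0 = 0
... | 1 = 1
... | _ = 2

beta : ℕ → ℕ
beta n with n % 6
... | 0 = 0
... | 4 = 2
... | _ = 1

gamma : ℕ → ℕ
gamma m with m % 6
... | 0 = 0
... | 5 = 1
... | _ = 2

-- Lower bound: summing 2 ≤ 2 |f(v)| + Σ_{u ∼ v} |f(u)| over a column gives
-- 2 m ≤ W(j-1) + 4 W(j) + W(j+1) for the column weights W.  By integrality, the amount by which a column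
-- stays below the claimed average is then at most the mean of the amounts by which its neighbours exceed it.
--
-- Upper bound: merging two adjacent rows, taking unions of labels, preserves 2RDFs and does not increase the
-- weight, and a 2RDF of C_3 □ C_n lifts to C_{3q} □ C_n.  So it suffices to tile C_3 □ C_n economically:
-- a perfect tiling of period 6 is closed up by an insertion of 1, 2 or 3 columns costing one unit of extra
-- weight; the residues 4 and 5 mod 6 are obtained by merging columns of the perfect tiling.

module Submission where

open import Defs
open import Data.Bool using (Bool; true; false; _∨_)
import Data.Bool.Properties as Bool
open import Data.Bool.Properties using (∨-zeroʳ; ∨-conicalˡ)
open import Data.Fin using (Fin; zero; suc; toℕ; combine; remQuot; finToFun; funToFin)
open import Data.Fin.Properties
  using (toℕ-injective; toℕ-fromℕ<; toℕ<n; all?; any?; finToFun-funToFin; remQuot-combine)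
import Data.Fin.Properties as Fin
open import Data.List using (List; []; _∷_; filter; map; allFin)
open import Data.List.Extrema.Nat using (argmin; argmin-all; f[argmin]≤v⁺)
open import Data.List.Membership.Propositional using (lose)
open import Data.List.Membership.Propositional.Properties using (∈-filter⁺; ∈-map⁺; ∈-allFin)
open import Data.List.Relation.Unary.All.Properties using (all-filter)
open import Data.Nat
  using (ℕ; zero; suc; _+_; _*_; _∸_; _^_; _≤_; _<_; _/_; _%_; _⊓_; _≤′_; z≤n; s≤s; ≤′-refl; ≤′-step; NonZero)
open import Data.Nat.DivMod
open import Data.Nat.Divisibility using (divides)
open import Data.Nat.Properties
open import Data.Nat.Tactic.RingSolver using (solve-∀)
open import Data.Product using (Σ; ∃; _×_; _,_; proj₁; proj₂; swap)
import Data.Sum as Sum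
open import Data.Sum using (_⊎_; inj₁; inj₂)
open import Data.Vec using ([]; _∷_; lookup)
open import Function using (_∘_)
open import Relation.Binary.PropositionalEquality
  using (_≡_; _≢_; _≗_; refl; sym; trans; cong; cong₂; subst; module ≡-Reasoning)
open import Relation.Nullary using (Dec; yes; no; contradiction)
open import Relation.Nullary.Decidable using (map′; _×-dec_; _⊎-dec_; _→-dec_; from-yes)

-- Finite sums

sumFin-cong : ∀ k {g h : Fin k → ℕ} → g ≗ h → sumFin k g ≡ sumFin k h
sumFin-cong zero    g≗h = refl
sumFin-cong (suc k) g≗h = cong₂ _+_ (g≗h zero) (sumFin-cong k (g≗h ∘ suc))

sumFin-mono : ∀ k {g h : Fin k → ℕ} → (∀ i → g i ≤ h i) → sumFin k g ≤ sumFin k h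
sumFin-mono zero    g≤h = z≤n
sumFin-mono (suc k) g≤h = +-mono-≤ (g≤h zero) (sumFin-mono k (g≤h ∘ suc))

sumFin-const : ∀ k c → sumFin k (λ _ → c) ≡ k * c
sumFin-const zero    c = refl
sumFin-const (suc k) c = cong (c +_) (sumFin-const k c)

+-interchange : ∀ a b c d → a + b + (c + d) ≡ a + c + (b + d)
+-interchange = solve-∀

sumFin-+ : ∀ k (g h : Fin k → ℕ) → sumFin k (λ i → g i + h i) ≡ sumFin k g + sumFin k h
sumFin-+ zero    g h = refl
sumFin-+ (suc k) g h = begin
  g zero + h zero + sumFin k (λ i → g (suc i) + h (suc i))
    ≡⟨ cong (g zero + h zero +_) (sumFin-+ k (g ∘ suc) (h ∘ suc)) ⟩
  g zero + h zero + (sumFin k (g ∘ suc) + sumFin k (h ∘ suc))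
    ≡⟨ +-interchange (g zero) (h zero) _ _ ⟩
  g zero + sumFin k (g ∘ suc) + (h zero + sumFin k (h ∘ suc)) ∎
  where
  open ≡-Reasoning

sumFin-swap : ∀ m n (g : Fin m → Fin n → ℕ) →
  sumFin m (λ i → sumFin n (g i)) ≡ sumFin n (λ j → sumFin m (λ i → g i j))
sumFin-swap zero    n g = sym (trans (sumFin-const n 0) (*-zeroʳ n))
sumFin-swap (suc m) n g = trans
  (cong (sumFin n (g zero) +_) (sumFin-swap m n (g ∘ suc)))
  (sym (sumFin-+ n (g zero) _))

-- The sum of `g 0` up to `g k` splits off either its first or its last term. These two agree, so
-- they cancel, and a sum around a cycle is invariant under rotation.
sumFin-shift : ∀ k (g : ℕ → ℕ) → g k ≡ g 0 → sumFin k (g ∘ suc ∘ toℕ) ≡ sumFin k (g ∘ toℕ)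
sumFin-shift k g gk≡g0 = +-cancelˡ-≡ (g 0) _ _ (begin
  g 0 + sumFin k (g ∘ suc ∘ toℕ) ≡⟨ telescope k g ⟩
  sumFin k (g ∘ toℕ) + g k       ≡⟨ +-comm (sumFin k (g ∘ toℕ)) (g k) ⟩
  g k + sumFin k (g ∘ toℕ)       ≡⟨ cong (_+ sumFin k (g ∘ toℕ)) gk≡g0 ⟩
  g 0 + sumFin k (g ∘ toℕ)       ∎)
  where
  open ≡-Reasoning
  telescope : ∀ k (g : ℕ → ℕ) → g 0 + sumFin k (g ∘ suc ∘ toℕ) ≡ sumFin k (g ∘ toℕ) + g k
  telescope zero    g = +-identityʳ (g 0)
  telescope (suc k) g = trans (cong (g 0 +_) (telescope k (g ∘ suc))) (sym (+-assoc (g 0) _ _))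

-- Adjacency in cycles

%-cong-+ : ∀ a b c m .{{_ : NonZero m}} → a % m ≡ b % m → (a + c) % m ≡ (b + c) % m
%-cong-+ a b c m a≡b = begin
  (a + c) % m         ≡⟨ %-distribˡ-+ a c m ⟩
  (a % m + c % m) % m ≡⟨ cong (λ x → (x + c % m) % m) a≡b ⟩
  (b % m + c % m) % m ≡⟨ %-distribˡ-+ b c m ⟨
  (b + c) % m         ∎
  where open ≡-Reasoning

[m%n+o]%n≡[m+o]%n : ∀ m n o .{{_ : NonZero n}} → (m % n + o) % n ≡ (m + o) % n
[m%n+o]%n≡[m+o]%n m n o = %-cong-+ (m % n) m o n (m%n%n≡m%n m n)

toℕ-mod : ∀ a m .{{_ : NonZero m}} → toℕ (a mod m) ≡ a % m
toℕ-mod a m = toℕ-fromℕ< (m%n<n a m)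

mod-cong : ∀ {a b} m .{{_ : NonZero m}} → a % m ≡ b % m → a mod m ≡ b mod m
mod-cong {a} {b} m a≡b = toℕ-injective (trans (toℕ-mod a m) (trans a≡b (sym (toℕ-mod b m))))

toℕ-% : ∀ {m} .{{_ : NonZero m}} (i : Fin m) → toℕ i % m ≡ toℕ i
toℕ-% i = m<n⇒m%n≡m (toℕ<n i)

toℕ[i]-mod : ∀ {m} .{{_ : NonZero m}} (i : Fin m) → toℕ i mod m ≡ i
toℕ[i]-mod {m} i = toℕ-injective (trans (toℕ-mod (toℕ i) m) (toℕ-% i))

CycleAdj-sym : ∀ {m} {i j : Fin m} → CycleAdj m i j → CycleAdj m j i
CycleAdj-sym = Sum.swap

CycleAdj-mod : ∀ k a → CycleAdj (suc k) (a mod suc k) (suc a mod suc k)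
CycleAdj-mod k a = inj₁ (begin
  (toℕ (a mod suc k) + 1) % suc k ≡⟨ cong (λ x → (x + 1) % suc k) (toℕ-mod a (suc k)) ⟩
  (a % suc k + 1) % suc k         ≡⟨ [m%n+o]%n≡[m+o]%n a (suc k) 1 ⟩
  (a + 1) % suc k                 ≡⟨ cong (_% suc k) (+-comm a 1) ⟩
  suc a % suc k                   ≡⟨ toℕ-mod (suc a) (suc k) ⟨
  toℕ (suc a mod suc k)           ∎)
  where open ≡-Reasoning

CycleAdj-mod⁻¹ : ∀ k a b → CycleAdj (suc k) (suc a mod suc k) b →
  b ≡ a mod suc k ⊎ b ≡ (2 + a) mod suc k
CycleAdj-mod⁻¹ k a b (inj₁ next) = inj₂ (toℕ-injective (begin
  toℕ b                               ≡⟨ next ⟨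
  (toℕ (suc a mod suc k) + 1) % suc k ≡⟨ cong (λ x → (x + 1) % suc k) (toℕ-mod (suc a) (suc k)) ⟩
  (suc a % suc k + 1) % suc k         ≡⟨ [m%n+o]%n≡[m+o]%n (suc a) (suc k) 1 ⟩
  (suc a + 1) % suc k                 ≡⟨ cong (_% suc k) (+-comm (suc a) 1) ⟩
  (2 + a) % suc k                     ≡⟨ toℕ-mod (2 + a) (suc k) ⟨
  toℕ ((2 + a) mod suc k)             ∎))
  where open ≡-Reasoning
CycleAdj-mod⁻¹ k a b (inj₂ next) = inj₁ (toℕ-injective (begin
  toℕ b                        ≡⟨ toℕ-% b ⟨
  toℕ b % suc k                ≡⟨ [m+n]%n≡m%n (toℕ b) (suc k) ⟨
  (toℕ b + suc k) % suc k      ≡⟨ cong (_% suc k) (+-assoc (toℕ b) 1 k) ⟨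
  -- Adding `k` undoes the `+ 1`, since `1 + k` vanishes modulo `suc k`.
  (toℕ b + 1 + k) % suc k      ≡⟨ %-cong-+ (toℕ b + 1) (suc a) k (suc k) toℕ[b]+1≡suc[a] ⟩
  (suc a + k) % suc k          ≡⟨ cong (_% suc k) (+-suc a k) ⟨
  (a + suc k) % suc k          ≡⟨ [m+n]%n≡m%n a (suc k) ⟩
  a % suc k                    ≡⟨ toℕ-mod a (suc k) ⟨
  toℕ (a mod suc k)            ∎))
  where
  open ≡-Reasoning
  toℕ[b]+1≡suc[a] : (toℕ b + 1) % suc k ≡ suc a % suc k
  toℕ[b]+1≡suc[a] = trans next (toℕ-mod (suc a) (suc k))

cycleAdj? : ∀ m (i j : Fin m) → Dec (CycleAdj m i j)
cycleAdj? (suc k) i j = (_ ≟ _) ⊎-dec (_ ≟ _)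

-- The lower bound

ι : Bool → ℕ
ι true  = 1
ι false = 0

∣∣L-split : ∀ l → ∣ l ∣L ≡ ι (has1 l) + ι (has2 l)
∣∣L-split (lab true  true)  = refl
∣∣L-split (lab true  false) = refl
∣∣L-split (lab false true)  = refl
∣∣L-split (lab false false) = refl

-- The deficit T ∸ 2 y has the parity of r, so if nonzero it is at least r.
deficit≤excess : ∀ q r x y z → r ≤ 2 → 2 * (q * 3 + r) ≤ x + 4 * y + z →
  2 * (2 * q + r ∸ 2 * y) ≤ (2 * x ∸ (2 * q + r)) + (2 * z ∸ (2 * q + r))
deficit≤excess q r x y z r≤2 bound with (2 * q + r ∸ 2 * y) ≟ 0
... | yes D≡0 = ≤-trans (≤-reflexive (cong (2 *_) D≡0)) z≤n
-- With `2 * T + 8 * y` added to both sides, the truncated differences `X` and `Z` enter only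
-- through `2 * x ≤ T + X` and `2 * z ≤ T + Z`; `D` is an exact difference because it is nonzero.
... | no  D≢0 = +-cancelʳ-≤ (2 * T + 8 * y) _ _ (begin
  2 * D + (2 * T + 8 * y)       ≤⟨ +-cancelʳ-≤ (2 * r) _ _ 2D+2T+8y+2r≤ ⟩
  2 * (2 * (q * 3 + r))         ≤⟨ *-monoʳ-≤ 2 bound ⟩
  2 * (x + 4 * y + z)           ≡⟨ expand x y z ⟩
  2 * x + 2 * z + 8 * y         ≤⟨ +-monoˡ-≤ (8 * y) (+-mono-≤ (m≤n+m∸n (2 * x) T) (m≤n+m∸n (2 * z) T)) ⟩
  T + X + (T + Z) + 8 * y       ≡⟨ collect T X Z (8 * y) ⟩
  X + Z + (2 * T + 8 * y)       ∎)
  where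
  open ≤-Reasoning
  T D X Z : ℕ
  T = 2 * q + r
  D = T ∸ 2 * y
  X = 2 * x ∸ T
  Z = 2 * z ∸ T

  r≤D : r ≤ 2 → D ≢ 0 → r ≤ D
  r≤D z≤n             _   = z≤n
  r≤D (s≤s z≤n)       D≢0 = n≢0⇒n>0 D≢0
  r≤D (s≤s (s≤s z≤n)) D≢0 = subst (2 ≤_) (sym D≡2e) (*-monoʳ-≤ 2 (n≢0⇒n>0 e≢0))
    where
    D≡2e : 2 * q + 2 ∸ 2 * y ≡ 2 * (q + 1 ∸ y)
    D≡2e = trans (cong (_∸ 2 * y) (sym (*-distribˡ-+ 2 q 1))) (sym (*-distribˡ-∸ 2 (q + 1) y))
    e≢0 : q + 1 ∸ y ≢ 0
    e≢0 e≡0 = D≢0 (trans D≡2e (cong (2 *_) e≡0))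

  2y≤T : 2 * y ≤ T
  2y≤T = <⇒≤ (m∸n≢0⇒n<m D≢0)

  expand : ∀ x y z → 2 * (x + 4 * y + z) ≡ 2 * x + 2 * z + 8 * y
  expand = solve-∀
  collect : ∀ t x z u → t + x + (t + z) + u ≡ x + z + (2 * t + u)
  collect = solve-∀
  regroup : ∀ d t y → 2 * d + (2 * t + 8 * y) + 2 * d ≡ 2 * t + 4 * (d + 2 * y)
  regroup = solve-∀
  six : ∀ q r → 2 * (2 * q + r) + 4 * (2 * q + r) ≡ 2 * (2 * (q * 3 + r)) + 2 * r
  six = solve-∀

  -- Six times `T` exceeds four times `q * 3 + r` by exactly `2 * r`, and this gap is paid for by
  -- one copy of `2 * D`.
  2D+2T+8y+2r≤ : 2 * D + (2 * T + 8 * y) + 2 * r ≤ 2 * (2 * (q * 3 + r)) + 2 * r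
  2D+2T+8y+2r≤ = begin
    2 * D + (2 * T + 8 * y) + 2 * r ≤⟨ +-monoʳ-≤ (2 * D + (2 * T + 8 * y)) (*-monoʳ-≤ 2 (r≤D r≤2 D≢0)) ⟩
    2 * D + (2 * T + 8 * y) + 2 * D ≡⟨ regroup D T y ⟩
    2 * T + 4 * (D + 2 * y)         ≡⟨ cong (λ t → 2 * T + 4 * t) (m∸n+n≡m 2y≤T) ⟩
    2 * T + 4 * T                   ≡⟨ six q r ⟩
    2 * (2 * (q * 3 + r)) + 2 * r   ∎

-- Pointwise, `T` plus the excess equals `2 * W` plus the deficit. Summed over the cycle, the total
-- deficit is at most the total excess, which leaves the average of `2 * W` at least `T`. The two
-- periodicity equations are those needed to rotate the sum by one and by two.
cyclic-average : ∀ n q r (W : ℕ → ℕ) → r ≤ 2 → W n ≡ W 0 → W (suc n) ≡ W 1 →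
  (∀ b → 2 * (q * 3 + r) ≤ W b + 4 * W (1 + b) + W (2 + b)) →
  (2 * q + r) * n ≤ 2 * sumFin n (W ∘ toℕ)
cyclic-average n q r W r≤2 Wn≡W0 W[1+n]≡W1 bound = +-cancelʳ-≤ (∑ excess) _ _ (begin
  T * n + ∑ excess
    ≡⟨ cong (_+ ∑ excess) (trans (*-comm T n) (sym (sumFin-const n T))) ⟩
  sumFin n (λ _ → T) + ∑ excess
    ≡⟨ sumFin-+ n _ _ ⟨
  sumFin n (λ j → T + excess (toℕ j))
    ≡⟨ sumFin-cong n (λ j → balance T (2 * W (toℕ j))) ⟩
  sumFin n (λ j → 2 * W (toℕ j) + deficit (toℕ j))
    ≡⟨ sumFin-+ n _ _ ⟩
  ∑ (λ b → 2 * W b) + ∑ deficit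
    ≡⟨ cong (_+ ∑ deficit) (∑-double W) ⟩
  2 * ∑ W + ∑ deficit
    ≤⟨ +-monoʳ-≤ (2 * ∑ W) ∑deficit≤∑excess ⟩
  2 * ∑ W + ∑ excess ∎)
  where
  open ≤-Reasoning
  T : ℕ
  T = 2 * q + r
  deficit excess : ℕ → ℕ
  deficit b = T ∸ 2 * W b
  excess b = 2 * W b ∸ T
  ∑ : (ℕ → ℕ) → ℕ
  ∑ g = sumFin n (g ∘ toℕ)

  -- Both sides are the maximum of `a` and `b`.
  balance : ∀ a b → a + (b ∸ a) ≡ b + (a ∸ b)
  balance zero    zero    = refl
  balance zero    (suc b) = sym (+-identityʳ (suc b))
  balance (suc a) zero    = +-identityʳ (suc a)
  balance (suc a) (suc b) = cong suc (balance a b)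

  ∑-double : ∀ g → ∑ (λ b → 2 * g b) ≡ 2 * ∑ g
  ∑-double g = trans (sumFin-+ n _ _) (cong (∑ g +_)
    (trans (sumFin-+ n _ _) (cong (∑ g +_) (trans (sumFin-const n 0) (*-zeroʳ n)))))

  shift₁ : ∀ g → ∑ (λ b → g (W (suc b))) ≡ ∑ (g ∘ W)
  shift₁ g = sumFin-shift n (g ∘ W) (cong g Wn≡W0)
  shift₂ : ∀ g → ∑ (λ b → g (W (2 + b))) ≡ ∑ (g ∘ W)
  shift₂ g = trans (sumFin-shift n (g ∘ W ∘ suc) (cong g W[1+n]≡W1)) (shift₁ g)

  -- Around the cycle every excess is used twice, once from each side, which cancels the factor 2 in
  -- `deficit≤excess`.
  ∑deficit≤∑excess : ∑ deficit ≤ ∑ excess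
  ∑deficit≤∑excess = *-cancelˡ-≤ 2 (begin
    2 * ∑ deficit                             ≡⟨ cong (2 *_) (shift₁ (λ w → T ∸ 2 * w)) ⟨
    2 * ∑ (deficit ∘ suc)                     ≡⟨ ∑-double (deficit ∘ suc) ⟨
    ∑ (λ b → 2 * deficit (suc b))             ≤⟨ sumFin-mono n (λ j → let b = toℕ j in
                                                   deficit≤excess q r (W b) (W (1 + b)) (W (2 + b)) r≤2 (bound b)) ⟩
    ∑ (λ b → excess b + excess (2 + b))       ≡⟨ sumFin-+ n _ _ ⟩
    ∑ excess + ∑ (λ b → excess (2 + b))       ≡⟨ cong (∑ excess +_) (shift₂ (λ w → 2 * w ∸ T)) ⟩
    ∑ excess + ∑ excess                       ≡⟨ cong (∑ excess +_) (+-identityʳ _) ⟨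
    2 * ∑ excess                              ∎)

-- Counting domination on the torus

module LowerBound (k l : ℕ) (f : Vertex (suc k) (suc l) → Label) (2rdf : Is2RDF (suc k) (suc l) f) where
  m n : ℕ
  m = suc k
  n = suc l

  cell : ℕ → ℕ → Label
  cell a b = f (a mod m , b mod n)

  w : ℕ → ℕ → ℕ
  w a b = ∣ cell a b ∣L

  -- The total of `c` over the four neighbours of the cell at `(1 + a , 1 + b)`. Centring there
  -- avoids subtraction in the indices.
  around : (Label → ℕ) → ℕ → ℕ → ℕ
  around c a b = c (cell a (1 + b)) + c (cell (2 + a) (1 + b)) + (c (cell (1 + a) b) + c (cell (1 + a) (2 + b)))

  around-1≤ : ∀ (h : Label → Bool) a b u → TorusAdj m n (suc a mod m , suc b mod n) u →
    h (f u) ≡ true → 1 ≤ around (ι ∘ h) a b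
  around-1≤ h a b (_ , j) (inj₁ (refl , adj)) hu with CycleAdj-mod⁻¹ l b j adj
  ... | inj₁ refl rewrite hu = m≤n⇒m≤o+n (ι (h (cell a (1 + b))) + _) (m≤m+n 1 _)
  ... | inj₂ refl rewrite hu = m≤n⇒m≤o+n (ι (h (cell a (1 + b))) + _) (m≤n+m 1 (ι (h (cell (1 + a) b))))
  around-1≤ h a b (i , _) (inj₂ (refl , adj)) hu with CycleAdj-mod⁻¹ k a i adj
  ... | inj₁ refl rewrite hu = m≤m+n 1 _
  ... | inj₂ refl rewrite hu = m≤n⇒m≤n+o (ι (h (cell (1 + a) b)) + _) (m≤n+m 1 (ι (h (cell a (1 + b)))))

  -- The colours are counted separately because a single neighbour may supply both of them.
  around-split : ∀ a b → around ∣_∣L a b ≡ around (ι ∘ has1) a b + around (ι ∘ has2) a b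
  around-split a b = trans
    (cong₂ _+_ (cong₂ _+_ (split a (1 + b)) (split (2 + a) (1 + b)))
               (cong₂ _+_ (split (1 + a) b) (split (1 + a) (2 + b))))
    (regroup (one a (1 + b)) (two a (1 + b)) (one (2 + a) (1 + b)) (two (2 + a) (1 + b))
             (one (1 + a) b) (two (1 + a) b) (one (1 + a) (2 + b)) (two (1 + a) (2 + b)))
    where
    one two : ℕ → ℕ → ℕ
    one a b = ι (has1 (cell a b))
    two a b = ι (has2 (cell a b))
    split : ∀ a b → w a b ≡ one a b + two a b
    split a b = ∣∣L-split (cell a b)
    regroup : ∀ a b c d e f g h → a + b + (c + d) + (e + f + (g + h)) ≡ a + c + (e + g) + (b + d + (f + h))
    regroup = solve-∀

  -- A nonempty cell reaches 2 by its own doubled weight; around an empty one, each colour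
  -- contributes at least one unit.
  cell-bound : ∀ a b → 2 ≤ around ∣_∣L a b + (w (1 + a) (1 + b) + w (1 + a) (1 + b))
  cell-bound a b with cell (1 + a) (1 + b) in eq
  ... | lab true  true  = m≤n⇒m≤o+n (around ∣_∣L a b) (s≤s (s≤s z≤n))
  ... | lab true  false = m≤n⇒m≤o+n (around ∣_∣L a b) ≤-refl
  ... | lab false true  = m≤n⇒m≤o+n (around ∣_∣L a b) ≤-refl
  ... | lab false false with 2rdf (suc a mod m , suc b mod n) (cong has1 eq , cong has2 eq)
  ...   | (u₁ , adj₁ , one) , (u₂ , adj₂ , two) = m≤n⇒m≤n+o 0
    (subst (2 ≤_) (sym (around-split a b))
      (+-mono-≤ (around-1≤ has1 a b u₁ adj₁ one) (around-1≤ has2 a b u₂ adj₂ two)))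

  W : ℕ → ℕ
  W b = sumFin m (λ i → w (toℕ i) b)

  w-periodic : ∀ a b → w (m + a) b ≡ w a b
  w-periodic a b = cong (λ i → ∣ f (i , b mod n) ∣L)
    (mod-cong {m + a} {a} m (trans (cong (_% m) (+-comm m a)) ([m+n]%n≡m%n a m)))

  W-periodic : ∀ b → W (n + b) ≡ W b
  W-periodic b = cong (λ j → sumFin m (λ i → ∣ f (toℕ i mod m , j) ∣L))
    (mod-cong {n + b} {b} n (trans (cong (_% n) (+-comm n b)) ([m+n]%n≡m%n b n)))

  shift₁ : ∀ b → sumFin m (λ i → w (1 + toℕ i) b) ≡ W b
  shift₁ b = sumFin-shift m (λ a → w a b) (trans (cong (λ a → w a b) (sym (+-identityʳ m))) (w-periodic 0 b))

  shift₂ : ∀ b → sumFin m (λ i → w (2 + toℕ i) b) ≡ W b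
  shift₂ b = trans
    (sumFin-shift m (λ a → w (1 + a) b) (trans (cong (λ a → w a b) (+-comm 1 m)) (w-periodic 1 b)))
    (shift₁ b)

  -- Summing `cell-bound` down a column counts `W (1 + b)` four times: twice as doubled own weight
  -- and once for each of the two neighbours inside the column. The adjacent columns enter once
  -- each.
  column-bound : ∀ b → 2 * m ≤ W b + 4 * W (1 + b) + W (2 + b)
  column-bound b = begin
    2 * m                                   ≡⟨ trans (*-comm 2 m) (sym (sumFin-const m 2)) ⟩
    sumFin m (λ _ → 2)                      ≤⟨ sumFin-mono m (λ i → cell-bound (toℕ i) b) ⟩
    sumFin m (λ i → around ∣_∣L (toℕ i) b + (w (1 + toℕ i) (1 + b) + w (1 + toℕ i) (1 + b)))
      ≡⟨ ∑-+ (λ a → around ∣_∣L a b) (λ a → w (1 + a) (1 + b) + w (1 + a) (1 + b))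
           (∑-+ (λ a → w a (1 + b) + w (2 + a) (1 + b)) (λ a → w (1 + a) b + w (1 + a) (2 + b))
             (∑-+ (λ a → w a (1 + b)) (λ a → w (2 + a) (1 + b)) refl (shift₂ (1 + b)))
             (∑-+ (λ a → w (1 + a) b) (λ a → w (1 + a) (2 + b)) (shift₁ b) (shift₁ (2 + b))))
           (∑-+ (λ a → w (1 + a) (1 + b)) (λ a → w (1 + a) (1 + b)) (shift₁ (1 + b)) (shift₁ (1 + b))) ⟩
    W (1 + b) + W (1 + b) + (W b + W (2 + b)) + (W (1 + b) + W (1 + b))
      ≡⟨ regroup (W b) (W (1 + b)) (W (2 + b)) ⟩
    W b + 4 * W (1 + b) + W (2 + b)         ∎
    where
    open ≤-Reasoning
    ∑-+ : ∀ (g h : ℕ → ℕ) {x y} → sumFin m (g ∘ toℕ) ≡ x → sumFin m (h ∘ toℕ) ≡ y →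
      sumFin m (λ i → g (toℕ i) + h (toℕ i)) ≡ x + y
    ∑-+ g h gx hy = trans (sumFin-+ m (g ∘ toℕ) (h ∘ toℕ)) (cong₂ _+_ gx hy)
    regroup : ∀ x y z → y + y + (x + z) + (y + y) ≡ x + 4 * y + z
    regroup = solve-∀

  weight≡∑W : weight m n f ≡ sumFin n (W ∘ toℕ)
  weight≡∑W = trans (sumFin-swap m n λ i j → ∣ f (i , j) ∣L) (sumFin-cong n λ j → sumFin-cong m λ i →
    sym (cong₂ (λ i j → ∣ f (i , j) ∣L) (toℕ[i]-mod i) (toℕ[i]-mod j)))

  lower-bound : (2 * (m / 3) + m % 3) * n ≤ 2 * weight m n f
  lower-bound = subst (λ x → (2 * (m / 3) + m % 3) * n ≤ 2 * x) (sym weight≡∑W)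
    (cyclic-average n (m / 3) (m % 3) W (≤-pred (m%n<n m 3))
      (trans (cong W (sym (+-identityʳ n))) (W-periodic 0))
      (trans (cong W (+-comm 1 n)) (W-periodic 1))
      (λ b → subst (λ x → 2 * x ≤ W b + 4 * W (1 + b) + W (2 + b)) m≡q*3+r (column-bound b)))
    where
    m≡q*3+r : m ≡ m / 3 * 3 + m % 3
    m≡q*3+r = trans (m≡m%n+[m/n]*n m 3) (+-comm (m % 3) _)

-- Thus `2 * (m / 3) + twoAlpha m` is the threshold `T` of `cyclic-average` for the division of `m`
-- by 3.
twoAlpha≡%3 : ∀ m → twoAlpha m ≡ m % 3
twoAlpha≡%3 m with m % 3 | m%n<n m 3
... | 0 | _ = refl
... | 1 | _ = refl
... | 2 | _ = refl
... | suc (suc (suc _)) | s≤s (s≤s (s≤s ()))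

-- Existence of the 2-rainbow domination number

-- Labellings are recovered from their numerical codes only up to pointwise equality, so the
-- properties used in the search must respect it.
Is2RDF-resp-≗ : ∀ m n {f g : Vertex m n → Label} → f ≗ g → Is2RDF m n f → Is2RDF m n g
Is2RDF-resp-≗ m n f≗g 2rdf v (e₁ , e₂) with 2rdf v (trans (cong has1 (f≗g v)) e₁ , trans (cong has2 (f≗g v)) e₂)
... | (u₁ , adj₁ , one) , (u₂ , adj₂ , two) =
  (u₁ , adj₁ , trans (sym (cong has1 (f≗g u₁))) one) , (u₂ , adj₂ , trans (sym (cong has2 (f≗g u₂))) two)

weight-cong : ∀ m n {f g : Vertex m n → Label} → f ≗ g → weight m n f ≡ weight m n g
weight-cong m n f≗g = sumFin-cong m λ i → sumFin-cong n λ j → cong ∣_∣L (f≗g (i , j))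

isEmpty? : ∀ l → Dec (IsEmpty l)
isEmpty? l = (has1 l Bool.≟ false) ×-dec (has2 l Bool.≟ false)

torusAdj? : ∀ m n u v → Dec (TorusAdj m n u v)
torusAdj? m n (i , j) (i' , j') = ((i Fin.≟ i') ×-dec cycleAdj? n j j') ⊎-dec ((j Fin.≟ j') ×-dec cycleAdj? m i i')

is2RDF? : ∀ m n f → Dec (Is2RDF m n f)
is2RDF? m n f = map′ (λ p (i , j) → p i j) (λ p i j → p (i , j))
  (all? λ i → all? λ j → isEmpty? (f (i , j)) →-dec (dominated? has1 (i , j) ×-dec dominated? has2 (i , j)))
  where
  dominated? : ∀ (h : Label → Bool) v → Dec (Σ (Vertex m n) λ u → TorusAdj m n v u × h (f u) ≡ true)
  dominated? h v = map′ (λ (i , j , p) → (i , j) , p) (λ ((i , j) , p) → i , j , p)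
    (any? λ i → any? λ j → torusAdj? m n v (i , j) ×-dec (h (f (i , j)) Bool.≟ true))

Label→Fin : Label → Fin 4
Label→Fin (lab false false) = zero
Label→Fin (lab true  false) = suc zero
Label→Fin (lab false true)  = suc (suc zero)
Label→Fin (lab true  true)  = suc (suc (suc zero))

Fin→Label : Fin 4 → Label
Fin→Label zero                   = lab false false
Fin→Label (suc zero)             = lab true false
Fin→Label (suc (suc zero))       = lab false true
Fin→Label (suc (suc (suc zero))) = lab true true

Fin→Label→Fin : ∀ l → Fin→Label (Label→Fin l) ≡ l
Fin→Label→Fin (lab false false) = refl
Fin→Label→Fin (lab true  false) = refl
Fin→Label→Fin (lab false true)  = refl
Fin→Label→Fin (lab true  true)  = refl

module _ (m n : ℕ) where

  -- A labelling is read as a number with `m * n` digits in base 4, which makes the search for a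
  -- minimum finite.
  decode : Fin (4 ^ (m * n)) → Vertex m n → Label
  decode c (i , j) = Fin→Label (finToFun c (combine i j))

  encode : (Vertex m n → Label) → Fin (4 ^ (m * n))
  encode f = funToFin (λ x → Label→Fin (f (remQuot n x)))

  decode-encode : ∀ f → decode (encode f) ≗ f
  decode-encode f (i , j) = begin
    Fin→Label (finToFun (encode f) (combine i j))
      ≡⟨ cong Fin→Label (finToFun-funToFin (λ x → Label→Fin (f (remQuot n x))) (combine i j)) ⟩
    Fin→Label (Label→Fin (f (remQuot n (combine i j))))
      ≡⟨ Fin→Label→Fin _ ⟩
    f (remQuot n (combine i j))
      ≡⟨ cong f (remQuot-combine i j) ⟩
    f (i , j) ∎
    where open ≡-Reasoning

  rdNumber : Σ ℕ (IsRDNumber m n)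
  rdNumber = weight m n best , (best , best-2RDF , refl) , best-minimal
    where
    functions : List (Vertex m n → Label)
    functions = map decode (allFin _)

    -- `full` is the default of `argmin`; having no empty vertex, it is vacuously a 2RDF.
    full best : Vertex m n → Label
    full _ = lab true true
    best = argmin (weight m n) full (filter (is2RDF? m n) functions)

    best-2RDF : Is2RDF m n best
    best-2RDF = argmin-all (weight m n) {P = Is2RDF m n} (λ _ ()) (all-filter (is2RDF? m n) functions)

    -- The list contains a pointwise copy of `f`, namely `decode (encode f)`, with the same weight.
    best-minimal : ∀ f → Is2RDF m n f → weight m n best ≤ weight m n f
    best-minimal f 2rdf = f[argmin]≤v⁺ {f = weight m n} full _ (inj₂ (lose
      (∈-filter⁺ (is2RDF? m n) (∈-map⁺ decode (∈-allFin (encode f)))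
        (Is2RDF-resp-≗ m n (sym ∘ decode-encode f) 2rdf))
      (≤-reflexive (weight-cong m n (decode-encode f)))))

-- Transposition, contraction and lifting of 2RDFs

-- The upper bound `c` on the domination number, as a witness. An inequality is used because merging
-- rows may lower the weight.
RDBound : ℕ → ℕ → ℕ → Set
RDBound m n c = Σ (Vertex m n → Label) λ f → Is2RDF m n f × weight m n f ≤ c

weaken : ∀ {m n c d} → c ≤ d → RDBound m n c → RDBound m n d
weaken c≤d (f , 2rdf , f≤c) = f , 2rdf , ≤-trans f≤c c≤d

transpose : ∀ {m n c} → RDBound m n c → RDBound n m c
transpose {m} {n} (f , 2rdf , f≤c) = f ∘ swap , 2rdf′ , subst (_≤ _) (sumFin-swap m n λ i j → ∣ f (i , j) ∣L) f≤c
  where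
  2rdf′ : Is2RDF n m (f ∘ swap)
  2rdf′ v empty with 2rdf (swap v) empty
  ... | (u₁ , adj₁ , one) , (u₂ , adj₂ , two) = (swap u₁ , Sum.swap adj₁ , one) , (swap u₂ , Sum.swap adj₂ , two)

_∪_ : Label → Label → Label
lab a b ∪ lab c d = lab (a ∨ c) (b ∨ d)

-- Lets one argument serve both colours: `h` is instantiated with `has1` and `has2`.
PreservesUnion : (Label → Bool) → Set
PreservesUnion h = ∀ l l′ → h (l ∪ l′) ≡ h l ∨ h l′

∣∪∣≤ : ∀ l l′ → ∣ l ∪ l′ ∣L ≤ ∣ l ∣L + ∣ l′ ∣L
∣∪∣≤ (lab a b) (lab c d) = begin
  ∣ lab (a ∨ c) (b ∨ d) ∣L      ≡⟨ ∣∣L-split (lab (a ∨ c) (b ∨ d)) ⟩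
  ι (a ∨ c) + ι (b ∨ d)         ≤⟨ +-mono-≤ (ι-∨ a c) (ι-∨ b d) ⟩
  ι a + ι c + (ι b + ι d)       ≡⟨ +-interchange (ι a) (ι b) (ι c) (ι d) ⟨
  ι a + ι b + (ι c + ι d)       ≡⟨ cong₂ _+_ (∣∣L-split (lab a b)) (∣∣L-split (lab c d)) ⟨
  ∣ lab a b ∣L + ∣ lab c d ∣L   ∎
  where
  open ≤-Reasoning
  ι-∨ : ∀ a b → ι (a ∨ b) ≤ ι a + ι b
  ι-∨ true  b = m≤m+n 1 (ι b)
  ι-∨ false b = ≤-refl

-- The contraction of the cycle edge between 0 and 1.
pinch₀ : ∀ {k} → Fin (2 + k) → Fin (1 + k)
pinch₀ zero    = zero
pinch₀ (suc i) = i

-- Represents the merged vertex by 0. If the union is empty then so is the label at 0, and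
-- domination there suffices.
section : ∀ {k} → Fin (1 + k) → Fin (2 + k)
section zero    = zero
section (suc i) = suc (suc i)

pinch₀-section : ∀ {k} (i : Fin (1 + k)) → pinch₀ (section i) ≡ i
pinch₀-section zero    = refl
pinch₀-section (suc i) = refl

-- Contracting an edge collapses that edge and sends every other step along the cycle to a step.
pinch₀-next : ∀ {k} (i j : Fin (2 + k)) → (toℕ i + 1) % (2 + k) ≡ toℕ j →
  pinch₀ i ≡ pinch₀ j ⊎ (toℕ (pinch₀ i) + 1) % (1 + k) ≡ toℕ (pinch₀ j)
pinch₀-next zero (suc zero) _ = inj₁ refl
-- The cases separate the last vertex, whose successor wraps around to 0 in both cycles, from the
-- others, whose successor cannot be 0.
pinch₀-next {k} (suc i) j next with m≤n⇒m<n∨m≡n (toℕ<n i)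
pinch₀-next {k} (suc i) zero next | inj₁ i+1<1+k =
  contradiction (trans (sym (m<n⇒m%n≡m (s≤s (subst (_< suc k) (+-comm 1 (toℕ i)) i+1<1+k)))) next) λ ()
pinch₀-next {k} (suc i) (suc j) next | inj₁ i+1<1+k = inj₂ (trans (m<n⇒m%n≡m i+1<)
  (suc-injective (trans (sym (m<n⇒m%n≡m (s≤s i+1<))) next)))
  where
  i+1< : toℕ i + 1 < suc k
  i+1< = subst (_< suc k) (+-comm 1 (toℕ i)) i+1<1+k
pinch₀-next {k} (suc i) zero next | inj₂ i+1≡1+k =
  inj₂ (trans (cong (_% suc k) (trans (+-comm (toℕ i) 1) i+1≡1+k)) (n%n≡0 (suc k)))
pinch₀-next {k} (suc i) (suc j) next | inj₂ i+1≡1+k =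
  contradiction (trans (sym (n%n≡0 (2 + k))) (trans (cong (_% (2 + k)) (sym 2+i≡2+k)) next)) λ ()
  where
  2+i≡2+k : suc (toℕ i + 1) ≡ 2 + k
  2+i≡2+k = cong suc (trans (+-comm (toℕ i) 1) i+1≡1+k)

pinch₀-adj : ∀ {k} (i j : Fin (2 + k)) → CycleAdj (2 + k) i j →
  pinch₀ i ≡ pinch₀ j ⊎ CycleAdj (1 + k) (pinch₀ i) (pinch₀ j)
pinch₀-adj i j (inj₁ next) = Sum.map₂ inj₁ (pinch₀-next i j next)
pinch₀-adj i j (inj₂ next) = Sum.map sym inj₂ (pinch₀-next j i next)

module Contract (k n : ℕ) (f : Vertex (2 + k) n → Label) (2rdf : Is2RDF (2 + k) n f) where

  merged : Vertex (1 + k) n → Label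
  merged (zero  , j) = f (zero , j) ∪ f (suc zero , j)
  merged (suc i , j) = f (suc (suc i) , j)

  merged-⊇ : ∀ h → PreservesUnion h → ∀ i j → h (f (i , j)) ≡ true → h (merged (pinch₀ i , j)) ≡ true
  merged-⊇ h h-∪ zero          j p = trans (h-∪ (f (zero , j)) (f (suc zero , j))) (cong (_∨ h (f (suc zero , j))) p)
  merged-⊇ h h-∪ (suc zero)    j p = trans (h-∪ (f (zero , j)) (f (suc zero , j)))
    (trans (cong (h (f (zero , j)) ∨_) p) (∨-zeroʳ (h (f (zero , j)))))
  merged-⊇ h h-∪ (suc (suc i)) j p = p

  merged-empty : ∀ i j → IsEmpty (merged (i , j)) → IsEmpty (f (section i , j))
  merged-empty zero    j (e₁ , e₂) = ∨-conicalˡ _ _ e₁ , ∨-conicalˡ _ _ e₂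
  merged-empty (suc i) j e         = e

  -- A neighbour merged into the vertex itself contributes nothing, since the vertex is empty.
  push : ∀ h → PreservesUnion h → ∀ i j → h (merged (i , j)) ≡ false →
    (Σ (Vertex (2 + k) n) λ u → TorusAdj (2 + k) n (section i , j) u × h (f u) ≡ true) →
    Σ (Vertex (1 + k) n) λ u → TorusAdj (1 + k) n (i , j) u × h (merged u) ≡ true
  push h h-∪ i j e ((_ , j′) , inj₁ (refl , adj) , p) =
    (i , j′) , inj₁ (refl , adj) ,
    subst (λ x → h (merged (x , j′)) ≡ true) (pinch₀-section i) (merged-⊇ h h-∪ (section i) j′ p)
  push h h-∪ i j e ((i′ , _) , inj₂ (refl , adj) , p) with pinch₀-adj (section i) i′ adj
  ... | inj₂ adj′ = (pinch₀ i′ , j) ,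
    inj₂ (refl , subst (λ x → CycleAdj (1 + k) x (pinch₀ i′)) (pinch₀-section i) adj′) , merged-⊇ h h-∪ i′ j p
  ... | inj₁ same = contradiction
    (trans (sym e) (subst (λ x → h (merged (x , j)) ≡ true) (trans (sym same) (pinch₀-section i)) (merged-⊇ h h-∪ i′ j p)))
    λ ()

  merged-2RDF : Is2RDF (1 + k) n merged
  merged-2RDF (i , j) e with 2rdf (section i , j) (merged-empty i j e)
  ... | one , two = push has1 (λ _ _ → refl) i j (proj₁ e) one , push has2 (λ _ _ → refl) i j (proj₂ e) two

  merged-weight : weight (1 + k) n merged ≤ weight (2 + k) n f
  merged-weight = begin
    sumFin n (λ j → ∣ f (zero , j) ∪ f (suc zero , j) ∣L) + rest
      ≤⟨ +-monoˡ-≤ rest (sumFin-mono n λ j → ∣∪∣≤ (f (zero , j)) (f (suc zero , j))) ⟩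
    sumFin n (λ j → ∣ f (zero , j) ∣L + ∣ f (suc zero , j) ∣L) + rest
      ≡⟨ cong (_+ rest) (sumFin-+ n (λ j → ∣ f (zero , j) ∣L) _) ⟩
    sumFin n (λ j → ∣ f (zero , j) ∣L) + sumFin n (λ j → ∣ f (suc zero , j) ∣L) + rest
      ≡⟨ +-assoc (sumFin n λ j → ∣ f (zero , j) ∣L) _ rest ⟩
    weight (2 + k) n f ∎
    where
    open ≤-Reasoning
    rest : ℕ
    rest = sumFin k λ i → sumFin n λ j → ∣ f (suc (suc i) , j) ∣L

contract : ∀ {k n c} → RDBound (2 + k) n c → RDBound (1 + k) n c
contract {k} {n} (f , 2rdf , f≤c) = merged , merged-2RDF , ≤-trans merged-weight f≤c
  where open Contract k n f 2rdf

contract* : ∀ {m m′ n c} → 1 ≤ m → m ≤ m′ → RDBound m′ n c → RDBound m n c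
contract* 1≤m m≤m′ = go 1≤m (≤⇒≤′ m≤m′)
  where
  go : ∀ {m m′ n c} → 1 ≤ m → m ≤′ m′ → RDBound m′ n c → RDBound m n c
  go 1≤m ≤′-refl b = b
  -- Contraction stops at the one-vertex cycle; going below it would contradict `1 ≤ m`.
  go {m′ = suc zero} 1≤m (≤′-step m≤m′) b with s≤s () ← ≤-trans (s≤s 1≤m) (s≤s (≤′⇒≤ m≤m′))
  go {m′ = suc (suc _)} 1≤m (≤′-step m≤m′) b = go 1≤m m≤m′ (contract b)

-- Reduction modulo 3 is a covering of `C_3` by a cycle whose length is a multiple of 3, so
-- neighbours lift.
CycleAdj-lift : ∀ q i r → CycleAdj 3 (toℕ i mod 3) r →
  ∃ λ i′ → CycleAdj (suc q * 3) i i′ × toℕ i′ mod 3 ≡ r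
CycleAdj-lift q i r (inj₁ next) = i′ , inj₁ (sym (toℕ-mod (toℕ i + 1) (suc q * 3))) , toℕ-injective (begin
  toℕ (toℕ i′ mod 3)                ≡⟨ toℕ-mod (toℕ i′) 3 ⟩
  toℕ i′ % 3                        ≡⟨ cong (_% 3) (toℕ-mod (toℕ i + 1) (suc q * 3)) ⟩
  (toℕ i + 1) % (suc q * 3) % 3     ≡⟨ m∣n⇒o%n%m≡o%m 3 (suc q * 3) (toℕ i + 1) (divides (suc q) refl) ⟩
  (toℕ i + 1) % 3                   ≡⟨ [m%n+o]%n≡[m+o]%n (toℕ i) 3 1 ⟨
  (toℕ i % 3 + 1) % 3               ≡⟨ cong (λ x → (x + 1) % 3) (toℕ-mod (toℕ i) 3) ⟨
  (toℕ (toℕ i mod 3) + 1) % 3       ≡⟨ next ⟩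
  toℕ r                             ∎)
  where
  open ≡-Reasoning
  i′ : Fin (suc q * 3)
  i′ = (toℕ i + 1) mod (suc q * 3)
CycleAdj-lift q i r (inj₂ next) = i′ , inj₂ i′+1≡i , toℕ-injective (begin
  toℕ (toℕ i′ mod 3)                ≡⟨ toℕ-mod (toℕ i′) 3 ⟩
  toℕ i′ % 3                        ≡⟨ cong (_% 3) (toℕ-mod (toℕ i + (2 + q * 3)) (suc q * 3)) ⟩
  (toℕ i + (2 + q * 3)) % (suc q * 3) % 3
    ≡⟨ m∣n⇒o%n%m≡o%m 3 (suc q * 3) (toℕ i + (2 + q * 3)) (divides (suc q) refl) ⟩
  (toℕ i + (2 + q * 3)) % 3         ≡⟨ cong (_% 3) (+-assoc (toℕ i) 2 (q * 3)) ⟨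
  (toℕ i + 2 + q * 3) % 3           ≡⟨ [m+kn]%n≡m%n (toℕ i + 2) q 3 ⟩
  (toℕ i + 2) % 3                   ≡⟨ %-cong-+ (toℕ i) (toℕ r + 1) 2 3 i≡r+1 ⟩
  (toℕ r + 1 + 2) % 3               ≡⟨ cong (_% 3) (+-assoc (toℕ r) 1 2) ⟩
  (toℕ r + 3) % 3                   ≡⟨ [m+n]%n≡m%n (toℕ r) 3 ⟩
  toℕ r % 3                         ≡⟨ toℕ-% r ⟩
  toℕ r                             ∎)
  where
  open ≡-Reasoning
  i′ : Fin (suc q * 3)
  -- The summand `2 + q * 3` represents -1 both modulo `suc q * 3` and modulo 3.
  i′ = (toℕ i + (2 + q * 3)) mod (suc q * 3)

  i≡r+1 : toℕ i % 3 ≡ (toℕ r + 1) % 3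
  i≡r+1 = sym (trans next (toℕ-mod (toℕ i) 3))

  i′+1≡i : (toℕ i′ + 1) % (suc q * 3) ≡ toℕ i
  i′+1≡i = begin
    (toℕ i′ + 1) % (suc q * 3)
      ≡⟨ cong (λ x → (x + 1) % (suc q * 3)) (toℕ-mod (toℕ i + (2 + q * 3)) (suc q * 3)) ⟩
    ((toℕ i + (2 + q * 3)) % (suc q * 3) + 1) % (suc q * 3)
      ≡⟨ [m%n+o]%n≡[m+o]%n (toℕ i + (2 + q * 3)) (suc q * 3) 1 ⟩
    (toℕ i + (2 + q * 3) + 1) % (suc q * 3)
      ≡⟨ cong (_% (suc q * 3)) (trans (+-assoc (toℕ i) _ 1) (cong (toℕ i +_) (+-comm (2 + q * 3) 1))) ⟩
    (toℕ i + suc q * 3) % (suc q * 3)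
      ≡⟨ [m+n]%n≡m%n (toℕ i) (suc q * 3) ⟩
    toℕ i % (suc q * 3)
      ≡⟨ toℕ-% i ⟩
    toℕ i ∎

-- The labelling is pulled back along the covering: domination is inherited from below, and each of
-- the three rows is repeated `suc q` times.
lift : ∀ q {n c} → RDBound 3 n c → RDBound (suc q * 3) n (suc q * c)
lift q {n} {c} (f , 2rdf , f≤c) = lifted , lifted-2RDF , (begin
  weight (suc q * 3) n lifted ≡⟨ sumFin-lift (suc q) (λ r → sumFin n λ j → ∣ f (r , j) ∣L) ⟩
  suc q * weight 3 n f        ≤⟨ *-monoʳ-≤ (suc q) f≤c ⟩
  suc q * c                   ∎)
  where
  open ≤-Reasoning
  lifted : Vertex (suc q * 3) n → Label
  lifted (i , j) = f (toℕ i mod 3 , j)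

  lift-neighbour : ∀ (h : Label → Bool) i j →
    (Σ (Vertex 3 n) λ u → TorusAdj 3 n (toℕ i mod 3 , j) u × h (f u) ≡ true) →
    Σ (Vertex (suc q * 3) n) λ u → TorusAdj (suc q * 3) n (i , j) u × h (lifted u) ≡ true
  lift-neighbour h i j ((_ , j′) , inj₁ (refl , adj) , p) = (i , j′) , inj₁ (refl , adj) , p
  lift-neighbour h i j ((r , _) , inj₂ (refl , adj) , p) with CycleAdj-lift q i r adj
  ... | i′ , adj′ , refl = (i′ , j) , inj₂ (refl , adj′) , p

  lifted-2RDF : Is2RDF (suc q * 3) n lifted
  lifted-2RDF (i , j) e with 2rdf (toℕ i mod 3 , j) e
  ... | one , two = lift-neighbour has1 i j one , lift-neighbour has2 i j two

  sumFin-lift : ∀ q (g : Fin 3 → ℕ) → sumFin (q * 3) (λ i → g (toℕ i mod 3)) ≡ q * sumFin 3 g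
  sumFin-lift zero    g = refl
  sumFin-lift (suc q) g = trans (cong (λ x → g₀ + (g₁ + (g₂ + x))) (sumFin-lift q g)) (assoc g₀ g₁ g₂ _)
    where
    g₀ g₁ g₂ : ℕ
    g₀ = g zero
    g₁ = g (suc zero)
    g₂ = g (suc (suc zero))
    assoc : ∀ a b c d → a + (b + (c + d)) ≡ a + (b + (c + 0)) + d
    assoc = solve-∀

-- Tilings of C_n □ C_3 by slices

Slice : Set
Slice = Fin 3 → Label

Sees : (Label → Bool) → Slice → Slice → Slice → Fin 3 → Set
Sees h a b c r = h (a r) ≡ true ⊎ h (c r) ≡ true ⊎ ∃ λ r′ → CycleAdj 3 r r′ × h (b r′) ≡ true

-- The 2RDF condition on the middle slice of a window of three. It is decidable, so concrete windows
-- are checked by evaluation.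
Fits : Slice → Slice → Slice → Set
Fits a b c = ∀ r → IsEmpty (b r) → Sees has1 a b c r × Sees has2 a b c r

fits? : ∀ a b c → Dec (Fits a b c)
fits? a b c = all? λ r → isEmpty? (b r) →-dec (sees? has1 r ×-dec sees? has2 r)
  where
  sees? : ∀ h r → Dec (Sees h a b c r)
  sees? h r = (h (a r) Bool.≟ true) ⊎-dec (h (c r) Bool.≟ true) ⊎-dec
    any? λ r′ → cycleAdj? 3 r r′ ×-dec (h (b r′) Bool.≟ true)

strip : (ℕ → Slice) → ∀ n → Vertex n 3 → Label
strip s n (j , r) = s (toℕ j) r

pred-mod : ∀ {k} (j : Fin (suc k)) → ∃ λ p → p ≤ k × suc p mod suc k ≡ j
pred-mod {k} zero    = k , ≤-refl , toℕ-injective (trans (toℕ-mod (suc k) (suc k)) (n%n≡0 (suc k)))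
pred-mod {k} (suc x) = toℕ x , <⇒≤ (toℕ<n x) , toℕ[i]-mod (suc x)

-- Each vertex is judged by the window around its slice. Away from the seam this is a window of the
-- infinite sequence; the two remaining windows, around the last and the first slice, cross the
-- seam.
strip-2RDF : ∀ l s → (∀ j → Fits (s j) (s (1 + j)) (s (2 + j))) →
  Fits (s l) (s (1 + l)) (s 0) → Fits (s (1 + l)) (s 0) (s 1) → Is2RDF (2 + l) 3 (strip s (2 + l))
strip-2RDF l s inner last first (j , r) e with pred-mod j
... | p , p≤1+l , refl = neighbour has1 (proj₁ sees) , neighbour has2 (proj₂ sees)
  where
  n : ℕ
  n = 2 + l

  at : ℕ → Slice
  at a = s (toℕ (a mod n))

  at-< : ∀ {a} → a < n → at a ≡ s a
  at-< {a} a<n = cong s (trans (toℕ-mod a n) (m<n⇒m%n≡m a<n))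

  at-wrap : ∀ {a} → a < n → at (a + n) ≡ s a
  at-wrap {a} a<n = cong s (trans (toℕ-mod (a + n) n) (trans ([m+n]%n≡m%n a n) (m<n⇒m%n≡m a<n)))

  fits-≡ : ∀ {a b c a′ b′ c′} → a ≡ a′ → b ≡ b′ → c ≡ c′ → Fits a′ b′ c′ → Fits a b c
  fits-≡ refl refl refl fits = fits

  fits-at : ∀ {a} → a ≤ 1 + l → Fits (at a) (at (1 + a)) (at (2 + a))
  fits-at {a} a≤1+l with m≤n⇒m<n∨m≡n a≤1+l
  -- The window is centred at slice 0.
  ... | inj₂ refl = fits-≡ (at-< ≤-refl) (at-wrap (s≤s z≤n)) (at-wrap (s≤s (s≤s z≤n))) first
  ... | inj₁ a<1+l with m≤n⇒m<n∨m≡n (≤-pred a<1+l)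
  -- The window is centred at the last slice.
  ...   | inj₂ refl = fits-≡ (at-< (m≤n+m (suc l) 1)) (at-< ≤-refl) (at-wrap (s≤s z≤n)) last
  ...   | inj₁ a<l  = fits-≡ (at-< (m≤n⇒m≤o+n 2 a<l)) (at-< (s≤s (m≤n⇒m≤o+n 1 a<l))) (at-< (s≤s (s≤s a<l))) (inner a)

  sees : Sees has1 (at p) (at (1 + p)) (at (2 + p)) r × Sees has2 (at p) (at (1 + p)) (at (2 + p)) r
  sees = fits-at p≤1+l r e

  neighbour : ∀ h → Sees h (at p) (at (1 + p)) (at (2 + p)) r →
    Σ (Vertex n 3) λ u → TorusAdj n 3 (suc p mod n , r) u × h (strip s n u) ≡ true
  neighbour h (inj₁ q)                       =
    (p mod n , r) , inj₂ (refl , CycleAdj-sym {n} {p mod n} {suc p mod n} (CycleAdj-mod (1 + l) p)) , q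
  neighbour h (inj₂ (inj₁ q))                =
    ((2 + p) mod n , r) , inj₂ (refl , CycleAdj-mod (1 + l) (1 + p)) , q
  neighbour h (inj₂ (inj₂ (r′ , adj , q)))   = (suc p mod n , r′) , inj₁ (refl , adj) , q

-- The perfect tiling of period 6 and its closures

pattern ∅ = lab false false
pattern ① = lab true false
pattern ② = lab false true
pattern ③ = lab true true

slice : Label → Label → Label → Slice
slice a b c = lookup (a ∷ b ∷ c ∷ [])

-- One label per slice, moving down one row each time with alternating colour; hence the period 6.
-- An empty vertex sees one colour in its own slice and the other in exactly one adjacent slice.
block : ℕ → Slice
block 0 = slice ① ∅ ∅
block 1 = slice ∅ ② ∅
block 2 = slice ∅ ∅ ①
block 3 = slice ② ∅ ∅
block 4 = slice ∅ ① ∅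
block 5 = slice ∅ ∅ ②
block (suc (suc (suc (suc (suc (suc j)))))) = block j

infixr 5 _◂_
_◂_ : List Slice → (ℕ → Slice) → ℕ → Slice
([]     ◂ s) j       = s j
((a ∷ _) ◂ s) zero   = a
((_ ∷ t) ◂ s) (suc j) = (t ◂ s) j

fits-block : ∀ j → Fits (block j) (block (1 + j)) (block (2 + j))
fits-block 0 = from-yes (fits? (block 0) (block 1) (block 2))
fits-block 1 = from-yes (fits? (block 1) (block 2) (block 3))
fits-block 2 = from-yes (fits? (block 2) (block 3) (block 4))
fits-block 3 = from-yes (fits? (block 3) (block 4) (block 5))
fits-block 4 = from-yes (fits? (block 4) (block 5) (block 0))
fits-block 5 = from-yes (fits? (block 5) (block 0) (block 1))
fits-block (suc (suc (suc (suc (suc (suc j)))))) = fits-block j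

-- The induction on `k` strips whole periods, so that `block` reduces to its last two slices.
fits-last : ∀ c → Fits (block 4) (block 5) c → ∀ k → Fits (block (4 + k * 6)) (block (5 + k * 6)) c
fits-last c fits zero    = fits
fits-last c fits (suc k) = fits-last c fits k

fits-first : ∀ b c → Fits (block 5) b c → ∀ k → Fits (block (5 + k * 6)) b c
fits-first b c fits zero    = fits
fits-first b c fits (suc k) = fits-first b c fits k

weight-block : ∀ k → weight (k * 6) 3 (strip block (k * 6)) ≡ k * 6
weight-block zero    = refl
weight-block (suc k) = cong (6 +_) (weight-block k)

tiling₀ : ∀ k → RDBound (suc k * 6) 3 (suc k * 6)
tiling₀ k = strip block _ ,
  strip-2RDF (4 + k * 6) block fits-block
    (fits-last _ (from-yes (fits? (block 4) (block 5) (block 0))) k)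
    (fits-first _ _ (from-yes (fits? (block 5) (block 0) (block 1))) k) ,
  ≤-reflexive (weight-block (suc k))

-- The inserted slice is the union of `block 0` and `block 5`: it acts as `block 0` for the slice
-- before it and as `block 5` for the slice after it.
tiling₁ : ∀ k → RDBound (1 + suc k * 6) 3 (2 + suc k * 6)
tiling₁ k = strip s _ ,
  strip-2RDF (5 + k * 6) s fits
    (fits-last _ (from-yes (fits? (block 4) (block 5) (s 0))) k)
    (fits-first _ _ (from-yes (fits? (block 5) (s 0) (s 1))) k) ,
  ≤-reflexive (cong (2 +_) (weight-block (suc k)))
  where
  s : ℕ → Slice
  s = (slice ① ∅ ② ∷ []) ◂ block
  fits : ∀ j → Fits (s j) (s (1 + j)) (s (2 + j))
  fits 0       = from-yes (fits? (s 0) (s 1) (s 2))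
  fits (suc j) = fits-block j

tiling₂ : ∀ k → RDBound (2 + suc k * 6) 3 (3 + suc k * 6)
tiling₂ k = strip s _ ,
  strip-2RDF (6 + k * 6) s fits
    (fits-last _ (from-yes (fits? (block 4) (block 5) (s 0))) k)
    (fits-first _ _ (from-yes (fits? (block 5) (s 0) (s 1))) k) ,
  ≤-reflexive (cong (3 +_) (weight-block (suc k)))
  where
  s : ℕ → Slice
  -- These are `block 0` and the union of `block 1` with `block 5`; the second closes up with the
  -- `block 0` that follows.
  s = (slice ① ∅ ∅ ∷ slice ∅ ② ② ∷ []) ◂ block
  fits : ∀ j → Fits (s j) (s (1 + j)) (s (2 + j))
  fits 0             = from-yes (fits? (s 0) (s 1) (s 2))
  fits 1             = from-yes (fits? (s 1) (s 2) (s 3))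
  fits (suc (suc j)) = fits-block j

tiling₃ : ∀ k → RDBound (3 + suc k * 6) 3 (4 + suc k * 6)
tiling₃ k = strip s _ ,
  strip-2RDF (7 + k * 6) s fits
    (fits-last _ (from-yes (fits? (block 4) (block 5) (s 0))) k)
    (fits-first _ _ (from-yes (fits? (block 5) (s 0) (s 1))) k) ,
  ≤-reflexive (cong (4 +_) (weight-block (suc k)))
  where
  s : ℕ → Slice
  -- The third slice is the union of `block 2` and `block 5`, whose labels fall on the same vertex.
  s = (slice ① ∅ ∅ ∷ slice ∅ ② ∅ ∷ slice ∅ ∅ ③ ∷ []) ◂ block
  fits : ∀ j → Fits (s j) (s (1 + j)) (s (2 + j))
  fits 0                   = from-yes (fits? (s 0) (s 1) (s 2))
  fits 1                   = from-yes (fits? (s 1) (s 2) (s 3))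
  fits 2                   = from-yes (fits? (s 2) (s 3) (s 4))
  fits (suc (suc (suc j))) = fits-block j

base-beta : ∀ n → 6 ≤ n → RDBound n 3 (n + beta n)
base-beta n 6≤n with n % 6 | n / 6 | m≡m%n+[m/n]*n n 6 | m%n<n n 6
... | r | zero | refl | r<6 = contradiction 6≤n (<⇒≱ (subst (_< 6) (sym (+-identityʳ r)) r<6))
... | 0 | suc k | refl | _ = weaken (≤-reflexive (sym (+-identityʳ _))) (tiling₀ k)
... | 1 | suc k | refl | _ = weaken (≤-reflexive (+-comm 1 _)) (tiling₁ k)
... | 2 | suc k | refl | _ = weaken (≤-reflexive (+-comm 1 _)) (tiling₂ k)
... | 3 | suc k | refl | _ = weaken (≤-reflexive (+-comm 1 _)) (tiling₃ k)
-- The weight remains that of the next multiple of 6, so two columns removed leave an excess of 2,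
-- and one column an excess of 1.
... | 4 | suc k | refl | _ = weaken (≤-reflexive (+-comm 2 _)) (contract (contract (tiling₀ (suc k))))
... | 5 | suc k | refl | _ = weaken (≤-reflexive (+-comm 1 _)) (contract (tiling₀ (suc k)))
... | suc (suc (suc (suc (suc (suc _))))) | suc k | refl | s≤s (s≤s (s≤s (s≤s (s≤s (s≤s ())))))

beta≤gamma : ∀ n → beta n ≤ gamma n
beta≤gamma n with n % 6
... | 0 = z≤n
... | 1 = s≤s z≤n
... | 2 = s≤s z≤n
... | 3 = s≤s z≤n
... | 4 = ≤-refl
... | 5 = ≤-refl
... | suc (suc (suc (suc (suc (suc _))))) = s≤s z≤n

-- Here the length starts at 3, so the lengths 3, 4 and 5, which contain no full period, are treated
-- directly.
base-gamma : ∀ m → 3 ≤ m → RDBound m 3 (m + gamma m)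
base-gamma 0 ()
base-gamma 1 (s≤s ())
base-gamma 2 (s≤s (s≤s ()))
base-gamma 3 _ = f , from-yes (is2RDF? 3 3 f) , s≤s (s≤s (s≤s (s≤s z≤n)))
  where
  f : Vertex 3 3 → Label
  -- The weight is 4, within the allowed `3 + gamma 3`, which is 5.
  f = strip ((slice ∅ ∅ ① ∷ slice ∅ ② ∅ ∷ []) ◂ λ _ → slice ③ ∅ ∅) 3
base-gamma 4 _ = contract (contract (tiling₀ 0))
base-gamma 5 _ = contract (tiling₀ 0)
-- From 6 on, the tilings for `beta` serve, as `beta` is at most `gamma`.
base-gamma m@(suc (suc (suc (suc (suc (suc k)))))) _ =
  weaken (+-monoʳ-≤ m (beta≤gamma m)) (base-beta m (m≤m+n 6 k))

-- From three rows to arbitrary tori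

thicken : ∀ m {n c} → 1 ≤ m → RDBound n 3 c → RDBound m n (⌈ m /3⌉ * c)
thicken m {n} {c} 1≤m b = go ⌈ m /3⌉ m≤⌈m/3⌉*3
  where
  go : ∀ q → m ≤ q * 3 → RDBound m n (q * c)
  go zero    m≤0 = contradiction (≤-trans 1≤m m≤0) λ ()
  -- Three rows are repeated to the multiple `suc q * 3`, at least `m`, and surplus rows are merged
  -- away at no cost.
  go (suc q) m≤  = contract* 1≤m m≤ (lift q (transpose b))

  m≤⌈m/3⌉*3 : m ≤ ⌈ m /3⌉ * 3
  m≤⌈m/3⌉*3 = +-cancelʳ-≤ 2 m _ (begin
    m + 2                             ≡⟨ m≡m%n+[m/n]*n (m + 2) 3 ⟩
    (m + 2) % 3 + ⌈ m /3⌉ * 3         ≤⟨ +-monoˡ-≤ (⌈ m /3⌉ * 3) (≤-pred (m%n<n (m + 2) 3)) ⟩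
    2 + ⌈ m /3⌉ * 3                   ≡⟨ +-comm 2 (⌈ m /3⌉ * 3) ⟩
    ⌈ m /3⌉ * 3 + 2                   ∎)
    where open ≤-Reasoning

theorem2 : (m n : ℕ) → 3 ≤ m → 6 ≤ n →
    Σ ℕ λ k → IsRDNumber m n k ×
    ((2 * (m / 3) + twoAlpha m) * n ≤ 2 * k) ×
    (k ≤ (⌈ m /3⌉ * (n + beta n)) ⊓ (⌈ n /3⌉ * (m + gamma m)))
theorem2 (suc m) (suc n) 3≤m 6≤n with rdNumber (suc m) (suc n)
... | _ , number@((f , 2rdf , refl) , minimal) = _ , number ,
  subst (λ α → (2 * (suc m / 3) + α) * suc n ≤ 2 * weight (suc m) (suc n) f) (sym (twoAlpha≡%3 (suc m)))
    (LowerBound.lower-bound m n f 2rdf) ,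
  ⊓-glb (below (thicken (suc m) (s≤s z≤n) (base-beta (suc n) 6≤n)))
        -- The second bound exchanges the directions: the tiling runs along the cycle of length
        -- `suc m`, and the result is transposed.
        (below (transpose (thicken (suc n) (s≤s z≤n) (base-gamma (suc m) 3≤m))))
  where
  below : ∀ {c} → RDBound (suc m) (suc n) c → weight (suc m) (suc n) f ≤ c
  below (g , 2rdf′ , g≤c) = ≤-trans (minimal g 2rdf′) g≤c
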